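{- For every $m\ge 1$, every finite weighted star metric, and every collection $K_1,\dots,K_m$ of non-empty sets of leaves of the star (the request types), there is a deterministic online algorithm for the parametrized metrical service system problem with request types $K_1,\dots,K_m$ on this star that is $2m$-competitive.
   Context: Parametrized metrical service system (MSS): given are a finite metric space $(X,d)$ and a fixed collection of $m$ non-empty subsets $K_1,\dots,K_m$ of $X$ (the request types), known to the algorithm in advance. An instance consists of an initial state $s_0\in X$ and a finite sequence of requests $\boldsymbol\rho=(\rho_1,\rho_2,\dots)$, each $\rho_t\in\{K_1,\dots,K_m\}$, revealed one at a time. On arrival of $\rho_t$, the algorithm must choose a state $s_t\in\rho_t$ without knowledge of future requests. The cost of a solution is $\sum_{t\ge1}d(s_{t-1},s_t)$. Let $\mathrm{cost}^*(\boldsymbol\rho)$ be the minimum cost of a feasible (offline) solution. A deterministic online algorithm $\mathcal A$ is $c$-competitive if there is a constant $\beta$, independent of the input sequence (but possibly depending on the metric space), such that $\mathrm{cost}_{\mathcal A}(\boldsymbol\rho)\le c\cdot \mathrm{cost}^*(\boldsymbol\rho)+\beta$ for every input. Weighted star: a root node to which each leaf $s$ is joined by a single edge of weight $d_s\ge 0$. The points (states) of the metric space are the leaves, and $d(s,s')=d_s+d_{s'}$ for distinct leaves $s,s'$ (and $d(s,s)=0$). -}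

module Defs where

open import Level using (_⊔_) renaming (suc to lsuc)
open import Algebra.Bundles using (CommutativeRing)
open import Data.Bool.Base using (true; false)
open import Data.Nat.Base using (ℕ)
open import Data.Fin.Base using (Fin; zero; suc)
open import Data.Fin.Properties using (_≟_)
open import Data.Fin.Subset using (Subset; _∈_; Nonempty)
open import Data.Fin.Subset.Properties using (nonempty?)
open import Data.Vec.Base using ([]; _∷_; here; there)
open import Data.List.Base using (List; []; _∷_)
open import Data.List.Relation.Binary.Pointwise.Base using (Pointwise; []; _∷_)
open import Data.Product.Base using (∃; _×_; _,_; proj₁; proj₂)
open import Data.Sum.Base using (inj₁; inj₂)
open import Relation.Binary.Core using (Rel)
open import Relation.Binary.Structures using (IsTotalOrder)
open import Relation.Nullary.Decidable.Core using (yes; no)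
open import Relation.Nullary.Negation.Core using (¬_; contradiction)
import Algebra.Properties.Semiring.Mult as Mult

-- The standard library has no real numbers.  Distances and costs take values
-- in an arbitrary totally ordered field, of which ℝ is (classically) an
-- instance; neither completeness nor the Archimedean property is assumed.
record OrderedField c ℓ₁ ℓ₂ : Set (lsuc (c ⊔ ℓ₁ ⊔ ℓ₂)) where
  infix 4 _≤_
  field
    commutativeRing : CommutativeRing c ℓ₁
  open CommutativeRing commutativeRing public renaming (zero to *-zero)
  field
    _≤_          : Rel Carrier ℓ₂
    isTotalOrder : IsTotalOrder _≈_ _≤_
    0≉1          : ¬ (0# ≈ 1#)
    inverse      : ∀ x → ¬ (x ≈ 0#) → ∃ λ y → x * y ≈ 1#
    +-monoˡ-≤    : ∀ z {x y} → x ≤ y → x + z ≤ y + z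
    *-nonNeg     : ∀ {x y} → 0# ≤ x → 0# ≤ y → 0# ≤ x * y

  module ≤ = IsTotalOrder isTotalOrder

  fromℕ : ℕ → Carrier
  fromℕ n = Mult._×_ semiring n 1#

module _ {c ℓ₁ ℓ₂} (F : OrderedField c ℓ₁ ℓ₂) where
  open OrderedField F

  record WeightedStar : Set (c ⊔ ℓ₂) where
    field
      leaves   : ℕ
      weight   : Fin leaves → Carrier
      weight≥0 : ∀ s → 0# ≤ weight s

    dist : Fin leaves → Fin leaves → Carrier
    dist s s′ with s ≟ s′
    ... | yes _ = 0#
    ... | no  _ = weight s + weight s′

  +-monoʳ-≤ : ∀ z {x y} → x ≤ y → z + x ≤ z + y
  +-monoʳ-≤ z {x} {y} x≤y =
    ≤.≤-respˡ-≈ (+-comm x z) (≤.≤-respʳ-≈ (+-comm y z) (+-monoˡ-≤ z x≤y))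

  minimizer : ∀ {n} (p : Subset n) → Nonempty p → (f : Fin n → Carrier) →
              ∃ λ s → s ∈ p × (∀ {s′} → s′ ∈ p → f s ≤ f s′)
  minimizer [] (() , _) f
  minimizer (b ∷ p) ne f with nonempty? p
  minimizer (false ∷ p) (suc s , there s∈p) f | no empty =
    contradiction (s , s∈p) empty
  minimizer (true ∷ p) ne f | no empty =
    zero , here , λ where
      here          → ≤.refl
      (there s′∈p)  → contradiction (_ , s′∈p) empty
  minimizer (false ∷ p) ne f | yes ne′ with minimizer p ne′ (λ i → f (suc i))
  ... | s , s∈p , least =
    suc s , there s∈p , λ where (there s′∈p) → least s′∈p
  minimizer (true ∷ p) ne f | yes ne′ with minimizer p ne′ (λ i → f (suc i))
  ... | s , s∈p , least with ≤.total (f zero) (f (suc s))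
  ...   | inj₁ f0≤fs = zero , here , λ where
            here         → ≤.refl
            (there s′∈p) → ≤.trans f0≤fs (least s′∈p)
  ...   | inj₂ fs≤f0 = suc s , there s∈p , λ where
            here         → fs≤f0
            (there s′∈p) → least s′∈p

-- The parametrized metrical service system on the points Fin n with distance
-- function d and request types K.  A request is given by the index of its
-- type.  The metric axioms play no role in the definitions.
module MSS {c ℓ₁ ℓ₂} (F : OrderedField c ℓ₁ ℓ₂)
           {n : ℕ} (d : Fin n → Fin n → OrderedField.Carrier F)
           {m : ℕ} (K : Fin m → Subset n) (K-nonempty : ∀ i → Nonempty (K i))
           where
  open OrderedField F

  State Request : Set
  State   = Fin n
  Request = Fin m

  Feasible : List State → List Request → Set
  Feasible = Pointwise (λ s i → s ∈ K i)

  cost : State → List State → Carrier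
  cost s₀ []       = 0#
  cost s₀ (s ∷ ss) = d s₀ s + cost s ss

  IsMinimumCost : State → List Request → Carrier → Set (ℓ₁ ⊔ ℓ₂)
  IsMinimumCost s₀ ρ v =
    (∃ λ ss → Feasible ss ρ × v ≈ cost s₀ ss) ×
    (∀ ss → Feasible ss ρ → v ≤ cost s₀ ss)

  minimumCost : ∀ s₀ ρ → ∃ (IsMinimumCost s₀ ρ)
  minimumCost s₀ [] =
    0# , ([] , [] , refl) , λ where [] [] → ≤.refl
  minimumCost s₀ (i ∷ ρ)
    with minimizer F (K i) (K-nonempty i)
           (λ s → d s₀ s + proj₁ (minimumCost s ρ))
  ... | s , s∈K , least with minimumCost s ρ
  ...   | v , (ss , feas , v≈) , _ =
    d s₀ s + v ,
    (s ∷ ss , s∈K ∷ feas , +-congˡ v≈) ,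
    λ where (s′ ∷ ss′) (s′∈K ∷ feas′) →
              ≤.trans (least s′∈K)
                (+-monoʳ-≤ F (d s₀ s′) (proj₂ (proj₂ (minimumCost s′ ρ)) ss′ feas′))

  cost* : State → List Request → Carrier
  cost* s₀ ρ = proj₁ (minimumCost s₀ ρ)

  -- A deterministic online algorithm picks the next state from the initial
  -- state, the earlier requests (most recent first) and the current request;
  -- its own earlier states are determined by these data.
  record OnlineAlgorithm : Set where
    field
      choose : State → List Request → Request → State
      valid  : ∀ s₀ past i → choose s₀ past i ∈ K i

    runFrom : State → List Request → List Request → List State
    runFrom s₀ past []      = []
    runFrom s₀ past (i ∷ ρ) = choose s₀ past i ∷ runFrom s₀ (i ∷ past) ρ

    run : State → List Request → List State
    run s₀ ρ = runFrom s₀ [] ρ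

  Competitive : Carrier → OnlineAlgorithm → Set (c ⊔ ℓ₂)
  Competitive r A =
    ∃ λ β → ∀ s₀ ρ → cost s₀ (OnlineAlgorithm.run A s₀ ρ) ≤ r * cost* s₀ ρ + β

{-# OPTIONS --safe #-}
module Submission where

-- A primal-dual argument.  Each request raises a dual amount y, filed in a
-- ledger together with the set of the types requested since.  A leaf collects
-- the amounts whose requests it could have served without ever moving.  When
-- the current leaf cannot serve a request, y is raised until some leaf s of the
-- requested type has collected its own weight, and the algorithm moves to s.
--
-- No leaf ever collects more than its weight, so leaving a leaf pays offline
-- for all it has collected: the total of the amounts is a lower bound for the
-- optimum.  Conversely, a move to s is paid by the amounts that s has
-- collected, and one amount pays at most m times, because between two of these
-- payments a new type joins its set.  The distances cost at most twice the
-- weights of the leaves moved to, whence the factor 2m.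

open import Defs
open import Level using (_⊔_)
open import Data.Bool.Base using (if_then_else_)
open import Data.Nat.Base as ℕ using (ℕ; zero; suc; pred; z≤n; s≤s; _≤_; _*_)
import Data.Nat.Properties as ℕ
open import Data.Fin.Base using (Fin; zero; suc)
open import Data.Fin.Properties using (_≟_; all?)
open import Data.Fin.Subset using (Subset; Nonempty; _∈_; _∉_; _∪_; ⁅_⁆; ⊥; ∣_∣)
open import Data.Fin.Subset.Properties
  using (_∈?_; ∉⊥; ∣⊥∣≡0; x∈⁅x⁆; x∈⁅y⁆⇒x≡y; p⊆p∪q; x∈p∪q⁺; x∈p∪q⁻;
         ∣p∣≤n; ∣p∣≤∣p∪q∣; p⊂q⇒∣p∣<∣q∣)
open import Data.List.Base using (List; []; _∷_; map; foldl; foldr)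
open import Data.List.Relation.Binary.Pointwise.Base using ([]; _∷_)
open import Data.Product.Base using (∃; _×_; _,_; proj₁; proj₂)
open import Data.Sum.Base using (_⊎_; inj₁; inj₂)
open import Function.Base using (_∘_; const)
open import Relation.Binary.Bundles using (Poset)
open import Relation.Binary.PropositionalEquality as ≡ using (_≡_)
open import Relation.Nullary.Decidable using (Dec; does; yes; no; _→-dec_)
open import Relation.Nullary.Negation using (¬_; contradiction)
import Algebra.Properties.Group as GroupProperties
import Algebra.Properties.Semiring.Mult as SemiringMult
import Algebra.Solver.Ring.NaturalCoefficients.Default as SemiringSolver
import Relation.Binary.Reasoning.PartialOrder as PosetReasoning

-- Sets of requested types, the leaves covering them, and credits.

module Coverage {n m : ℕ} (K : Fin m → Subset n) where

  Covers : Fin n → Subset m → Set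
  Covers s R = ∀ j → j ∈ R → s ∈ K j

  -- Opaque, since otherwise the decision unfolds before with-abstraction.
  opaque
    covers? : ∀ s R → Dec (Covers s R)
    covers? s R = all? λ j → (j ∈? R) →-dec (s ∈? K j)

  covers-⊥ : ∀ s → Covers s ⊥
  covers-⊥ s j j∈⊥ = contradiction j∈⊥ ∉⊥

  covers-∪⁺ : ∀ {s i R} → s ∈ K i → Covers s R → Covers s (R ∪ ⁅ i ⁆)
  covers-∪⁺ {i = i} {R} s∈K cov j j∈ with x∈p∪q⁻ R ⁅ i ⁆ j∈
  ... | inj₁ j∈R = cov j j∈R
  ... | inj₂ j∈i with x∈⁅y⁆⇒x≡y i j∈i
  ...   | ≡.refl = s∈K

  covers-∪⁻ : ∀ {s i R} → Covers s (R ∪ ⁅ i ⁆) → Covers s R × s ∈ K i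
  covers-∪⁻ {i = i} {R} cov =
    (λ j j∈R → cov j (p⊆p∪q ⁅ i ⁆ j∈R)) , cov i (x∈p∪q⁺ {p = R} (inj₂ (x∈⁅x⁆ i)))

  covers : Fin n → Subset m → ℕ
  covers s R = if does (covers? s R) then 1 else 0

  -- How often an amount with the set R may have paid for a move when the
  -- algorithm is in s.
  credit : Fin n → Subset m → ℕ
  credit s R = if does (covers? s R) then ∣ R ∣ else pred ∣ R ∣

  covers-⊥≡1 : ∀ s → covers s ⊥ ≡ 1
  covers-⊥≡1 s with covers? s ⊥
  ... | yes _ = ≡.refl
  ... | no ¬c = contradiction (covers-⊥ s) ¬c

  covers-∪-∈ : ∀ {s i} → s ∈ K i → ∀ R → covers s (R ∪ ⁅ i ⁆) ≡ covers s R
  covers-∪-∈ {s} {i} s∈K R with covers? s (R ∪ ⁅ i ⁆) | covers? s R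
  ... | yes _  | yes _ = ≡.refl
  ... | yes c  | no ¬c = contradiction (proj₁ (covers-∪⁻ {R = R} c)) ¬c
  ... | no ¬c  | yes c = contradiction (covers-∪⁺ s∈K c) ¬c
  ... | no _   | no _  = ≡.refl

  covers-∪-∉ : ∀ {s i} → s ∉ K i → ∀ R → covers s (R ∪ ⁅ i ⁆) ≡ 0
  covers-∪-∉ {s} {i} s∉K R with covers? s (R ∪ ⁅ i ⁆)
  ... | yes c = contradiction (proj₂ (covers-∪⁻ {R = R} c)) s∉K
  ... | no _  = ≡.refl

  credit-⊥ : ∀ s → credit s ⊥ ≡ 0
  credit-⊥ s with covers? s ⊥
  ... | yes _ = ∣⊥∣≡0 m
  ... | no ¬c = contradiction (covers-⊥ s) ¬c

  credit≤m : ∀ s R → credit s R ≤ m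
  credit≤m s R with covers? s R
  ... | yes _ = ∣p∣≤n R
  ... | no _  = ℕ.≤-trans ℕ.pred[n]≤n (∣p∣≤n R)

  -- As `s` can serve `i`, adding `i` does not change whether `s` covers the set, and cardinality
  -- only grows.
  credit-stay : ∀ {s i} → s ∈ K i → ∀ R → credit s R ≤ credit s (R ∪ ⁅ i ⁆)
  credit-stay {s} {i} s∈K R with covers? s R | covers? s (R ∪ ⁅ i ⁆)
  ... | yes _ | yes _ = ∣p∣≤∣p∪q∣ R ⁅ i ⁆
  ... | yes c | no ¬c = contradiction (covers-∪⁺ s∈K c) ¬c
  ... | no ¬c | yes c = contradiction (proj₁ (covers-∪⁻ {R = R} c)) ¬c
  ... | no _  | no _  = ℕ.pred-mono-≤ (∣p∣≤∣p∪q∣ R ⁅ i ⁆)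

  -- A set covered by `s` cannot already contain a type that `s` does not serve.
  ∣∪∣-fresh : ∀ {s i R} → s ∉ K i → Covers s R → ∣ R ∣ ℕ.< ∣ R ∪ ⁅ i ⁆ ∣
  ∣∪∣-fresh {i = i} {R} s∉K cov = p⊂q⇒∣p∣<∣q∣
    (p⊆p∪q ⁅ i ⁆ , i , x∈p∪q⁺ {p = R} (inj₂ (x∈⁅x⁆ i)) , s∉K ∘ cov i)

  -- Every leaf covers the empty set. Hence the `pred` in `credit` always loses exactly one.
  ¬covers⇒∣∣>0 : ∀ {s} R → ¬ Covers s R → 0 ℕ.< ∣ R ∣
  ¬covers⇒∣∣>0 {s} R ¬c = ℕ.n≢0⇒n>0 λ ∣R∣≡0 → ¬c λ j j∈R →
    contradiction (ℕ.≤-trans (positive j∈R) (ℕ.≤-reflexive ∣R∣≡0)) λ ()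
    where
    positive : ∀ {j} → j ∈ R → 0 ℕ.< ∣ R ∣
    positive {j} j∈R = ≡.subst (ℕ._< ∣ R ∣) (∣⊥∣≡0 m)
      (p⊂q⇒∣p∣<∣q∣ ((λ x∈⊥ → contradiction x∈⊥ ∉⊥) , j , j∈R , ∉⊥))

  -- If `s` covers `R`, then `i` is new to `R`, and the larger cardinality makes up for a payment or
  -- for the `pred` on the right. If not, the `pred` on the left has kept back one unit, which a
  -- payment for the move to a covering `s′` uses up.
  credit-move : ∀ {s i} → s ∉ K i → ∀ s′ R →
                credit s R ℕ.+ covers s′ (R ∪ ⁅ i ⁆) ≤ credit s′ (R ∪ ⁅ i ⁆)
  credit-move {s} {i} s∉K s′ R with covers? s R | covers? s′ (R ∪ ⁅ i ⁆)
  ... | yes c | yes _ =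
    ℕ.≤-trans (ℕ.≤-reflexive (ℕ.+-comm ∣ R ∣ 1)) (∣∪∣-fresh s∉K c)
  ... | yes c | no _  =
    ℕ.≤-trans (ℕ.≤-reflexive (ℕ.+-identityʳ ∣ R ∣)) (ℕ.<⇒≤pred (∣∪∣-fresh s∉K c))
  ... | no ¬c | yes _ = begin
    pred ∣ R ∣ ℕ.+ 1   ≡⟨ ℕ.+-comm (pred ∣ R ∣) 1 ⟩
    suc (pred ∣ R ∣)   ≡⟨ ℕ.suc-pred ∣ R ∣ {{ℕ.>-nonZero (¬covers⇒∣∣>0 R ¬c)}} ⟩
    ∣ R ∣              ≤⟨ ∣p∣≤∣p∪q∣ R ⁅ i ⁆ ⟩
    ∣ R ∪ ⁅ i ⁆ ∣      ∎
    where open ℕ.≤-Reasoning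
  ... | no _ | no _   =
    ℕ.≤-trans (ℕ.≤-reflexive (ℕ.+-identityʳ (pred ∣ R ∣)))
      (ℕ.pred-mono-≤ (∣p∣≤∣p∪q∣ R ⁅ i ⁆))

-- Order and natural multiples in an ordered field.

module OrderedFieldProperties {c ℓ₁ ℓ₂} (F : OrderedField c ℓ₁ ℓ₂) where
  open OrderedField F renaming (_≤_ to _⊑_; _*_ to _·_)
  open GroupProperties +-group public using () renaming
    (//-rightDividesˡ to x-y+y≈x; //-rightDividesʳ to x+y-y≈x)
  open SemiringMult semiring using (×-assoc-*)
  open SemiringMult semiring public using () renaming
    (_×_ to _×ₙ_; ×-congˡ to ×ₙ-congˡ; ×-congʳ to ×ₙ-congʳ;
     ×-homo-+ to ×ₙ-homo-+; ×-assocˡ to ×ₙ-assocˡ)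

  poset : Poset c ℓ₁ ℓ₂
  poset = record { isPartialOrder = ≤.isPartialOrder }

  +-mono-⊑ : ∀ {a b x y} → a ⊑ b → x ⊑ y → a + x ⊑ b + y
  +-mono-⊑ {b = b} {x = x} a⊑b x⊑y = ≤.trans (+-monoˡ-≤ x a⊑b) (+-monoʳ-≤ F b x⊑y)

  x⊑y+x : ∀ {x y} → 0# ⊑ y → x ⊑ y + x
  x⊑y+x {x} 0⊑y = ≤.≤-respˡ-≈ (+-identityˡ x) (+-monoˡ-≤ x 0⊑y)

  0⊑x+y : ∀ {x y} → 0# ⊑ x → 0# ⊑ y → 0# ⊑ x + y
  0⊑x+y 0⊑x 0⊑y = ≤.trans 0⊑y (x⊑y+x 0⊑x)

  ⊑⇒0⊑- : ∀ {x y} → x ⊑ y → 0# ⊑ y - x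
  ⊑⇒0⊑- {x} x⊑y = ≤.≤-respˡ-≈ (-‿inverseʳ x) (+-monoˡ-≤ (- x) x⊑y)

  +-cancelʳ-⊑ : ∀ z {x y} → x + z ⊑ y + z → x ⊑ y
  +-cancelʳ-⊑ z {x} {y} x+z⊑y+z = ≤.≤-respˡ-≈ (x+y-y≈x z x)
    (≤.≤-respʳ-≈ (x+y-y≈x z y) (+-monoˡ-≤ (- z) x+z⊑y+z))

  ×ₙ-nonNeg : ∀ n {x} → 0# ⊑ x → 0# ⊑ n ×ₙ x
  ×ₙ-nonNeg zero    0⊑x = ≤.refl
  ×ₙ-nonNeg (suc n) 0⊑x = 0⊑x+y 0⊑x (×ₙ-nonNeg n 0⊑x)

  ×ₙ-monoʳ : ∀ n {x y} → x ⊑ y → n ×ₙ x ⊑ n ×ₙ y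
  ×ₙ-monoʳ zero    x⊑y = ≤.refl
  ×ₙ-monoʳ (suc n) x⊑y = +-mono-⊑ x⊑y (×ₙ-monoʳ n x⊑y)

  ×ₙ-monoˡ : ∀ {k n x} → 0# ⊑ x → k ≤ n → k ×ₙ x ⊑ n ×ₙ x
  ×ₙ-monoˡ {n = n} 0⊑x z≤n   = ×ₙ-nonNeg n 0⊑x
  ×ₙ-monoˡ 0⊑x (s≤s k≤n) = +-monoʳ-≤ F _ (×ₙ-monoˡ 0⊑x k≤n)

  ×ₙ-fromℕ : ∀ n x → n ×ₙ x ≈ fromℕ n · x
  ×ₙ-fromℕ n x = sym (trans (×-assoc-* n 1# x) (×ₙ-congʳ n (*-identityˡ x)))

  bounded : ∀ {n} (f : Fin n → Carrier) → ∃ λ b → ∀ i → f i ⊑ b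
  bounded {zero}  f = 0# , λ ()
  bounded {suc n} f with bounded (f ∘ suc)
  ... | b , f⊑b with ≤.total (f zero) b
  ...   | inj₁ f0⊑b = b , λ where
            zero    → f0⊑b
            (suc i) → f⊑b i
  ...   | inj₂ b⊑f0 = f zero , λ where
            zero    → ≤.refl
            (suc i) → ≤.trans (f⊑b i) b⊑f0

-- Weighted sums over ledgers.

module Ledgers {c ℓ₁ ℓ₂} (F : OrderedField c ℓ₁ ℓ₂) (m : ℕ) where
  open OrderedField F renaming (_≤_ to _⊑_; _*_ to _·_)
  open OrderedFieldProperties F
  open SemiringSolver commutativeSemiring using (solve; _:+_; _:=_)

  Ledger : Set (c ⊔ ℓ₂)
  Ledger = List ((∃ λ y → 0# ⊑ y) × Subset m)

  -- The total, the amounts collected by a leaf and the credits are all of this form, so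
  -- inequalities between natural numbers, set by set, carry over to sums of field elements.
  tally : (Subset m → ℕ) → Ledger → Carrier
  tally w []                  = 0#
  tally w (((y , _) , R) ∷ L) = w R ×ₙ y + tally w L

  touch : Fin m → Ledger → Ledger
  touch i = map λ (y , R) → y , R ∪ ⁅ i ⁆

  -- Shifts a request from the ledger to the weight function, so that the sums before and after it
  -- run over the same ledger.
  tally-touch : ∀ w i L → tally w (touch i L) ≡ tally (λ R → w (R ∪ ⁅ i ⁆)) L
  tally-touch w i []      = ≡.refl
  tally-touch w i (_ ∷ L) = ≡.cong (_ +_) (tally-touch w i L)

  tally-cong : ∀ {v w} → (∀ R → v R ≡ w R) → ∀ L → tally v L ≈ tally w L
  tally-cong v≡w []            = refl
  tally-cong v≡w ((_ , R) ∷ L) = +-cong (×ₙ-congˡ (v≡w R)) (tally-cong v≡w L)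

  tally-mono : ∀ {v w} → (∀ R → v R ≤ w R) → ∀ L → tally v L ⊑ tally w L
  tally-mono v≤w []                    = ≤.refl
  tally-mono v≤w (((_ , 0⊑y) , R) ∷ L) =
    +-mono-⊑ (×ₙ-monoˡ 0⊑y (v≤w R)) (tally-mono v≤w L)

  tally-0 : ∀ L → tally (const 0) L ≈ 0#
  tally-0 []      = refl
  tally-0 (_ ∷ L) = trans (+-identityˡ _) (tally-0 L)

  tally-nonNeg : ∀ w L → 0# ⊑ tally w L
  tally-nonNeg w L = ≤.≤-respˡ-≈ (tally-0 L) (tally-mono (λ _ → z≤n) L)

  tally-+ : ∀ v w L → tally (λ R → v R ℕ.+ w R) L ≈ tally v L + tally w L
  tally-+ v w []                  = sym (+-identityˡ 0#)
  tally-+ v w (((y , _) , R) ∷ L) = trans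
    (+-cong (×ₙ-homo-+ y (v R) (w R)) (tally-+ v w L))
    (solve 4 (λ a b p q → ((a :+ b) :+ (p :+ q)) := ((a :+ p) :+ (b :+ q))) refl
      (v R ×ₙ y) (w R ×ₙ y) (tally v L) (tally w L))

  total : Ledger → Carrier
  total = tally (const 1)

  tally-const : ∀ n L → tally (const n) L ≈ n ×ₙ total L
  tally-const zero    L = tally-0 L
  tally-const (suc n) L =
    trans (tally-+ (const 1) (const n) L) (+-congˡ (tally-const n L))

-- Distances and collected amounts on the star.

module Algorithm {c ℓ₁ ℓ₂} (F : OrderedField c ℓ₁ ℓ₂) (star : WeightedStar F) {m : ℕ}
                 (K : Fin m → Subset (WeightedStar.leaves star))
                 (K-nonempty : ∀ i → Nonempty (K i)) where
  open OrderedField F renaming (_≤_ to _⊑_; _*_ to _·_)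
  open WeightedStar star
  open MSS F dist K K-nonempty
  open OrderedFieldProperties F
  open Ledgers F m
  open Coverage K
  open SemiringSolver commutativeSemiring using (solve; _:+_; _:=_; con)
  open PosetReasoning poset

  dist-≡ : ∀ s → dist s s ≈ 0#
  dist-≡ s with s ≟ s
  ... | yes _  = refl
  ... | no s≢s = contradiction ≡.refl s≢s

  dist-⊑ : ∀ s s′ → dist s s′ ⊑ weight s + weight s′
  dist-⊑ s s′ with s ≟ s′
  ... | yes _ = 0⊑x+y (weight≥0 s) (weight≥0 s′)
  ... | no _  = ≤.refl

  collected : State → Ledger → Carrier
  collected s = tally (covers s)

  collected-∈ : ∀ {s i} → s ∈ K i → ∀ L → collected s (touch i L) ≈ collected s L
  collected-∈ {s} {i} s∈K L =
    trans (reflexive (tally-touch (covers s) i L)) (tally-cong (covers-∪-∈ s∈K) L)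

  collected-∉ : ∀ {s i} → s ∉ K i → ∀ L → collected s (touch i L) ≈ 0#
  collected-∉ {s} {i} s∉K L =
    trans (reflexive (tally-touch (covers s) i L))
      (trans (tally-cong (covers-∪-∉ s∉K) L) (tally-0 L))

  -- Configurations, responses and the online algorithm.

  record Configuration : Set (c ⊔ ℓ₂) where
    field
      position         : State
      ledger           : Ledger
      collected⊑weight : ∀ s → collected s ledger ⊑ weight s
  open Configuration

  record Response (g : Configuration) (i : Request) : Set (c ⊔ ℓ₁ ⊔ ℓ₂) where
    field
      next     : State
      next∈K   : next ∈ K i
      amount   : Carrier
      amount≥0 : 0# ⊑ amount
      slack    : ∀ {s} → s ∈ K i → amount + collected s (ledger g) ⊑ weight s
      reason   : (position g ∈ K i × next ≡ position g) ⊎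
                 (position g ∉ K i × amount + collected next (ledger g) ≈ weight next)

    -- The new amount enters with the empty set, which every leaf covers at credit 0. The subsequent
    -- `touch i` then treats it like all older amounts.
    raised : Ledger
    raised = ((amount , amount≥0) , ⊥) ∷ ledger g

    collected-raised : ∀ s → collected s raised ≈ amount + collected s (ledger g)
    collected-raised s =
      +-congʳ (trans (×ₙ-congˡ (covers-⊥≡1 s)) (+-identityʳ amount))

    total-raised : total (touch i raised) ≈ amount + total (ledger g)
    total-raised = trans (reflexive (tally-touch (const 1) i raised))
      (+-congʳ (+-identityʳ amount))

    credit-raised : ∀ s → tally (credit s) raised ≈ tally (credit s) (ledger g)
    credit-raised s = trans (+-congʳ (×ₙ-congˡ (credit-⊥ s))) (+-identityˡ _)

    outcome : Configuration
    outcome = record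
      { position         = next
      ; ledger           = touch i raised
      ; collected⊑weight = bound
      }
      where
      bound : ∀ s → collected s (touch i raised) ⊑ weight s
      -- A leaf of the requested type gains `amount`, which `slack` permits; any other leaf drops to
      -- zero.
      bound s with s ∈? K i
      ... | yes s∈K = ≤.≤-respˡ-≈
        (sym (trans (collected-∈ s∈K raised) (collected-raised s))) (slack s∈K)
      ... | no s∉K  = ≤.≤-respˡ-≈ (sym (collected-∉ s∉K raised)) (weight≥0 s)

  respond : ∀ g i → Response g i
  respond g i with position g ∈? K i
  ... | yes p∈K = record
    { next     = position g
    ; next∈K   = p∈K
    ; amount   = 0#
    ; amount≥0 = ≤.refl
    ; slack    = λ {s} _ → ≤.≤-respˡ-≈ (sym (+-identityˡ _)) (collected⊑weight g s)
    ; reason   = inj₁ (p∈K , ≡.refl)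
    }
  -- The least remaining gap belongs to the leaf that becomes tight first, and raising by this gap
  -- overfills no leaf of `K i`.
  ... | no p∉K with minimizer F (K i) (K-nonempty i)
                      (λ s → weight s - collected s (ledger g))
  ...   | s , s∈K , least = record
    { next     = s
    ; next∈K   = s∈K
    ; amount   = weight s - collected s (ledger g)
    ; amount≥0 = ⊑⇒0⊑- (collected⊑weight g s)
    ; slack    = λ {s′} s′∈K →
        ≤.≤-respʳ-≈ (x-y+y≈x _ _) (+-monoˡ-≤ (collected s′ (ledger g)) (least s′∈K))
    ; reason   = inj₂ (p∉K , x-y+y≈x _ _)
    }

  serve : Configuration → Request → Configuration
  serve g i = Response.outcome (respond g i)

  initial : State → Configuration
  initial s = record { position = s ; ledger = [] ; collected⊑weight = weight≥0 }

  -- With the most recent request first, `configuration s (i ∷ past)` unfolds to one `serve` step,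
  -- as the recursion in `online-cost` requires.
  configuration : State → List Request → Configuration
  configuration s = foldr (λ i g → serve g i) (initial s)

  algorithm : OnlineAlgorithm
  algorithm = record
    { choose = λ s past i → position (serve (configuration s past) i)
    ; valid  = λ s past i → Response.next∈K (respond (configuration s past) i)
    }
  open OnlineAlgorithm algorithm using (run; runFrom)

  -- Amortised cost of the algorithm.

  paid : Configuration → Carrier
  paid g = 2 ×ₙ tally (credit (position g)) (ledger g)

  -- The weight of the current leaf is kept as a prepayment for leaving it. A move thus charges
  -- `weight next` twice, for arrival and for later departure, whence the factor 2 in `paid`.
  response-cost : ∀ {g i} (r : Response g i) → let open Response r in
    (dist (position g) next + weight next) + paid g ⊑
    weight (position g) + paid outcome
  response-cost {g} {i} r@(record { reason = inj₁ (p∈K , ≡.refl) }) = begin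
    (dist p p + weight p) + paid g
      ≈⟨ +-congʳ (trans (+-congʳ (dist-≡ p)) (+-identityˡ (weight p))) ⟩
    weight p + paid g
      ≤⟨ +-monoʳ-≤ F (weight p) (×ₙ-monoʳ 2 credit-grows) ⟩
    weight p + paid outcome
      ∎
    where
    open Response r
    p = position g
    credit-grows : tally (credit p) (ledger g) ⊑ tally (credit p) (touch i raised)
    credit-grows = begin
      tally (credit p) (ledger g)                  ≈⟨ credit-raised p ⟨
      tally (credit p) raised                      ≤⟨ tally-mono (credit-stay p∈K) raised ⟩
      tally (λ R → credit p (R ∪ ⁅ i ⁆)) raised    ≡⟨ tally-touch (credit p) i raised ⟨
      tally (credit p) (touch i raised)            ∎
  response-cost {g} {i} r@(record { reason = inj₂ (p∉K , tight) }) = begin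
    (dist p next + weight next) + paid g
      ≤⟨ +-monoˡ-≤ (paid g) (+-monoˡ-≤ (weight next) (dist-⊑ p next)) ⟩
    ((weight p + weight next) + weight next) + paid g
      ≈⟨ solve 3 (λ a b x → (((a :+ b) :+ b) :+ (x :+ (x :+ con 0))) :=
                            (a :+ ((x :+ b) :+ ((x :+ b) :+ con 0)))) refl
           (weight p) (weight next) (tally (credit p) (ledger g)) ⟩
    weight p + 2 ×ₙ (tally (credit p) (ledger g) + weight next)
      ≤⟨ +-monoʳ-≤ F (weight p) (×ₙ-monoʳ 2 credit-pays) ⟩
    weight p + paid outcome
      ∎
    where
    open Response r
    p = position g
    -- Since `next` is tight, its weight equals what it has collected in `raised`; then
    -- `credit-move` applies entry by entry.
    credit-pays : tally (credit p) (ledger g) + weight next ⊑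
                  tally (credit next) (touch i raised)
    credit-pays = begin
      tally (credit p) (ledger g) + weight next
        ≈⟨ +-cong (credit-raised p) (trans (collected-raised next) tight) ⟨
      tally (credit p) raised + collected next raised
        ≈⟨ +-congˡ (collected-∈ next∈K raised) ⟨
      tally (credit p) raised + collected next (touch i raised)
        ≡⟨ ≡.cong (tally (credit p) raised +_) (tally-touch (covers next) i raised) ⟩
      tally (credit p) raised + tally (λ R → covers next (R ∪ ⁅ i ⁆)) raised
        ≈⟨ tally-+ (credit p) (λ R → covers next (R ∪ ⁅ i ⁆)) raised ⟨
      tally (λ R → credit p R ℕ.+ covers next (R ∪ ⁅ i ⁆)) raised
        ≤⟨ tally-mono (credit-move p∉K next) raised ⟩
      tally (λ R → credit next (R ∪ ⁅ i ⁆)) raised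
        ≡⟨ tally-touch (credit next) i raised ⟨
      tally (credit next) (touch i raised)
        ∎

  -- Lower bound for offline solutions.

  response-total : ∀ {g i o o′} (r : Response g i) → o′ ∈ K i → let open Response r in
    amount + collected o (ledger g) ⊑ dist o o′ + collected o′ (touch i raised)
  response-total {g} {i} {o} {o′} r o′∈K with o ≟ o′
  -- Staying is free, but the leaf itself collects the new amount.
  ... | yes ≡.refl = ≤.reflexive (sym
    (trans (+-identityˡ _) (trans (collected-∈ o′∈K raised) (collected-raised o))))
    where open Response r
  -- The `weight o` in the distance covers all that `o` has collected, and the new amount is
  -- collected by `o′`.
  ... | no _ = begin
    amount + collected o (ledger g)                  ≤⟨ +-mono-⊑ amount⊑ (collected⊑weight g o) ⟩
    collected o′ (touch i raised) + weight o         ≈⟨ +-comm _ _ ⟩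
    weight o + collected o′ (touch i raised)         ≤⟨ +-monoˡ-≤ _ weight⊑ ⟩
    weight o + weight o′ + collected o′ (touch i raised)  ∎
    where
    open Response r
    weight⊑ : weight o ⊑ weight o + weight o′
    weight⊑ = ≤.≤-respʳ-≈ (+-comm _ _) (x⊑y+x (weight≥0 o′))
    amount⊑ : amount ⊑ collected o′ (touch i raised)
    amount⊑ = begin
      amount                             ≤⟨ x⊑y+x (tally-nonNeg (covers o′) (ledger g)) ⟩
      collected o′ (ledger g) + amount   ≈⟨ +-comm _ _ ⟩
      amount + collected o′ (ledger g)   ≈⟨ trans (collected-∈ o′∈K raised) (collected-raised o′) ⟨
      collected o′ (touch i raised)      ∎

  -- Here `a` stands for the cost already incurred. The invariant is advanced by adding
  -- `response-cost` and cancelling the old weight and payments.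
  online-cost : ∀ {s a w₀} past ρ → let g = configuration s past in
    a + weight (position g) ⊑ w₀ + paid g →
    a + cost (position g) (runFrom s past ρ) ⊑ w₀ + paid (foldl serve g ρ)
  online-cost {s} {a} {w₀} past [] inv = begin
    a + 0#                     ≤⟨ +-monoʳ-≤ F a (weight≥0 (position g)) ⟩
    a + weight (position g)    ≤⟨ inv ⟩
    w₀ + paid g                ∎
    where g = configuration s past
  online-cost {s} {a} {w₀} past (i ∷ ρ) inv = begin
    a + (dist p p′ + rest)               ≈⟨ +-assoc a _ rest ⟨
    (a + dist p p′) + rest               ≤⟨ online-cost (i ∷ past) ρ inv′ ⟩
    w₀ + paid (foldl serve (serve g i) ρ)   ∎
    where
    g = configuration s past
    p = position g
    p′ = position (serve g i)
    rest = cost p′ (runFrom s (i ∷ past) ρ)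
    inv′ : (a + dist p p′) + weight p′ ⊑ w₀ + paid (serve g i)
    inv′ = +-cancelʳ-⊑ (weight p + paid g) (begin
      ((a + dist p p′) + weight p′) + (weight p + paid g)
        ≈⟨ solve 5 (λ a d w′ w x → (((a :+ d) :+ w′) :+ (w :+ x)) :=
                                   ((a :+ w) :+ ((d :+ w′) :+ x))) refl
             a (dist p p′) (weight p′) (weight p) (paid g) ⟩
      (a + weight p) + ((dist p p′ + weight p′) + paid g)
        ≤⟨ +-mono-⊑ inv (response-cost (respond g i)) ⟩
      (w₀ + paid g) + (weight p + paid (serve g i))
        ≈⟨ solve 4 (λ a b c d → ((a :+ b) :+ (c :+ d)) := ((a :+ d) :+ (c :+ b))) refl
             w₀ (paid g) (weight p) (paid (serve g i)) ⟩
      (w₀ + paid (serve g i)) + (weight p + paid g)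
        ∎)

  -- With `a` the offline cost so far and `o` the offline state, the part of the total not yet paid
  -- for is what `o` has collected. At the end this rest is at most `weight o`, hence at most `D`.
  offline-cost : ∀ {D} → (∀ s → weight s ⊑ D) → ∀ {a o ss ρ} g → Feasible ss ρ →
    total (ledger g) ⊑ a + collected o (ledger g) →
    total (ledger (foldl serve g ρ)) ⊑ (a + cost o ss) + D
  offline-cost {D} w⊑D {a} {o} g [] inv = begin
    total (ledger g)                ≤⟨ inv ⟩
    a + collected o (ledger g)
      ≤⟨ +-monoʳ-≤ F a (≤.trans (collected⊑weight g o) (w⊑D o)) ⟩
    a + D                           ≈⟨ +-congʳ (+-identityʳ a) ⟨
    (a + 0#) + D                    ∎
  offline-cost {D} w⊑D {a} {o} {o′ ∷ ss} {i ∷ ρ} g (o′∈K ∷ feasible) inv = begin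
    total (ledger (foldl serve (serve g i) ρ))
      ≤⟨ offline-cost w⊑D (serve g i) feasible inv′ ⟩
    ((a + dist o o′) + cost o′ ss) + D
      ≈⟨ +-congʳ (+-assoc a _ _) ⟩
    (a + (dist o o′ + cost o′ ss)) + D
      ∎
    where
    open Response (respond g i)
    inv′ : total (touch i raised) ⊑ (a + dist o o′) + collected o′ (touch i raised)
    inv′ = begin
      total (touch i raised)                              ≈⟨ total-raised ⟩
      amount + total (ledger g)                           ≤⟨ +-monoʳ-≤ F amount inv ⟩
      amount + (a + collected o (ledger g))
        ≈⟨ solve 3 (λ y a x → (y :+ (a :+ x)) := (a :+ (y :+ x))) refl
             amount a (collected o (ledger g)) ⟩
      a + (amount + collected o (ledger g))
        ≤⟨ +-monoʳ-≤ F a (response-total (respond g i) o′∈K) ⟩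
      a + (dist o o′ + collected o′ (touch i raised))     ≈⟨ +-assoc a _ _ ⟨
      (a + dist o o′) + collected o′ (touch i raised)     ∎

  -- The competitive ratio.

  competitive : Competitive (fromℕ (2 * m)) algorithm
  competitive with bounded weight
  -- One `D` bounds the weight of the initial leaf; `r · D` comes from the amounts collected by the
  -- last offline leaf, scaled by the ratio.
  ... | D , w⊑D = r · D + D , bound
    where
    r = fromℕ (2 * m)
    bound : ∀ s ρ → cost s (run s ρ) ⊑ r · cost* s ρ + (r · D + D)
    bound s ρ with minimumCost s ρ
    ... | v , (ss , feasible , v≈) , _ = begin
      cost s (run s ρ)                       ≈⟨ +-identityˡ _ ⟨
      0# + cost s (run s ρ)                  ≤⟨ online-cost [] ρ initially ⟩
      weight s + paid end                    ≤⟨ +-mono-⊑ (w⊑D s) paid⊑ ⟩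
      D + r · (v + D)                        ≈⟨ +-congˡ (distribˡ r v D) ⟩
      D + (r · v + r · D)                    ≈⟨ +-comm _ _ ⟩
      (r · v + r · D) + D                    ≈⟨ +-assoc _ _ _ ⟩
      r · v + (r · D + D)                    ∎
      where
      end = foldl serve (initial s) ρ
      initially : 0# + weight s ⊑ weight s + 2 ×ₙ 0#
      initially = ≤.reflexive
        (solve 1 (λ w → (con 0 :+ w) := (w :+ (con 0 :+ (con 0 :+ con 0)))) refl (weight s))
      total⊑ : total (ledger end) ⊑ v + D
      total⊑ = begin
        total (ledger end)
          ≤⟨ offline-cost w⊑D (initial s) feasible (≤.reflexive (sym (+-identityˡ 0#))) ⟩
        (0# + cost s ss) + D
          ≈⟨ +-congʳ (trans (+-identityˡ _) (sym v≈)) ⟩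
        v + D
          ∎
      paid⊑ : paid end ⊑ r · (v + D)
      paid⊑ = begin
        paid end
          ≤⟨ ×ₙ-monoʳ 2 (tally-mono (credit≤m (position end)) (ledger end)) ⟩
        2 ×ₙ tally (const m) (ledger end)
          ≈⟨ ×ₙ-congʳ 2 (tally-const m (ledger end)) ⟩
        2 ×ₙ (m ×ₙ total (ledger end))
          ≈⟨ ×ₙ-assocˡ _ 2 m ⟩
        (2 * m) ×ₙ total (ledger end)
          ≤⟨ ×ₙ-monoʳ (2 * m) total⊑ ⟩
        (2 * m) ×ₙ (v + D)
          ≈⟨ ×ₙ-fromℕ (2 * m) _ ⟩
        r · (v + D)
          ∎

theorem1p2 : ∀ {c ℓ₁ ℓ₂} (F : OrderedField c ℓ₁ ℓ₂) (m : ℕ) → 1 ≤ m →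
    (star : WeightedStar F) →
    (K : Fin m → Subset (WeightedStar.leaves star)) →
    (K-nonempty : ∀ i → Nonempty (K i)) →
    ∃ λ A → MSS.Competitive F (WeightedStar.dist star) K K-nonempty
    (OrderedField.fromℕ F (2 * m)) A
theorem1p2 F m _ star K K-nonempty = algorithm , competitive
  where open Algorithm F star K K-nonempty
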